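{- Let $G$ be an Eulerian planar triangulation with planar dual $G^*$, whose vertices are properly coloured blue, red and green (adjacent vertices receive different colours). Suppose that every cycle of $G$ all of whose vertices are red or green contains a vertex whose degree in $G$ is $4$. Then $G^*$ is Hamiltonian, that is, $G^*$ has a cycle passing through every vertex of $G^*$.
   Context: A planar triangulation is a finite simple graph with at least $4$ vertices, embedded in the plane (equivalently the sphere), in which every face, including the outer face, is bounded by a $3$-cycle. It is Eulerian if every vertex has even degree. Its planar dual $G^*$ has one vertex for each face of $G$ (including the outer face), and for each edge $e$ of $G$ an edge joining the two faces incident to $e$; it is a cubic $3$-connected planar graph. "Cycle of $G$" means any cycle in $G$ as a subgraph (not necessarily induced or facial). -}

module Defs where

open import Data.Fin using (Fin; toℕ)
open import Data.Fin.Permutation using (Permutation′; _⟨$⟩ʳ_)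
open import Data.Fin.Properties using (_≟_)
open import Data.List using (length; filter; allFin)
open import Data.Nat using (ℕ; suc; _+_; _≤_)
open import Data.Nat.Divisibility using (_∣_)
open import Data.Nat.DivMod using (_mod_)
open import Data.Nat.GeneralisedArithmetic using (iterate)
open import Data.Product using (∃-syntax; _×_)
open import Function.Bundles using (_⇔_)
open import Function.Definitions using (Injective; StrictlySurjective)
open import Relation.Binary.Construct.Closure.ReflexiveTransitive using (Star)
open import Relation.Binary.PropositionalEquality using (_≡_; _≢_)

-- Finite graphs, with loops and parallel edges allowed. Every edge is a pair
-- {x , inv x} of oppositely directed darts; the dart x runs from src x to tgt x.
record Graph : Set where
  field
    order  : ℕ
    #darts : ℕ

  Vertex : Set
  Vertex = Fin order

  Dart : Set
  Dart = Fin #darts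

  field
    src            : Dart → Vertex
    inv            : Dart → Dart
    inv-involutive : ∀ x → inv (inv x) ≡ x
    inv-≢          : ∀ x → inv x ≢ x

  tgt : Dart → Vertex
  tgt x = src (inv x)

  Adjacent : Vertex → Vertex → Set
  Adjacent u v = ∃[ x ] (src x ≡ u × tgt x ≡ v)

  degree : Vertex → ℕ
  degree v = length (filter (λ x → src x ≟ v) (allFin #darts))

  Simple : Set
  Simple = (∀ x → src x ≢ tgt x)
         × (∀ x y → src x ≡ src y → tgt x ≡ tgt y → x ≡ y)

  Connected : Set
  Connected = ∀ u v → Star Adjacent u v

  Eulerian : Set
  Eulerian = ∀ v → 2 ∣ degree v

next : ∀ {k} → Fin (suc k) → Fin (suc k)
next {k} i = suc (toℕ i) mod suc k

module _ (G : Graph) where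
  open Graph G

  -- c lists the successive darts of a cycle of length suc k. The last field
  -- says that no edge is traversed in both directions; it only matters for
  -- closed walks of length 2.
  record IsCycle {k : ℕ} (c : Fin (suc k) → Dart) : Set where
    field
      closed            : ∀ i → tgt (c i) ≡ src (c (next i))
      distinct-vertices : Injective _≡_ _≡_ (λ i → src (c i))
      distinct-edges    : ∀ i j → c i ≢ inv (c j)

  Hamiltonian : Set
  Hamiltonian = ∃[ k ] ∃[ c ] (IsCycle {k} c × (∀ v → ∃[ i ] src (c i) ≡ v))

-- A numbering of the orbits of f. For a permutation of a finite set the
-- forward orbits are the orbits.
record Orbits {d : ℕ} (f : Fin d → Fin d) : Set where
  field
    count      : ℕ
    orbit      : Fin d → Fin count
    surjective : StrictlySurjective _≡_ orbit
    same-orbit : ∀ x y → orbit x ≡ orbit y ⇔ (∃[ k ] iterate f x k ≡ y)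

-- Graphs without isolated vertices cellularly embedded in a closed oriented
-- surface: α reverses darts, σ sends a dart to the next one in the cyclic order
-- around its source, and φ sends a dart to the next one along the boundary of
-- the face on a fixed side of it. Vertices, edges and faces are the orbits of
-- σ, α and φ.
record CombinatorialMap : Set where
  field
    #darts       : ℕ
    σ            : Permutation′ #darts
    α            : Fin #darts → Fin #darts
    α-involutive : ∀ x → α (α x) ≡ x
    α-≢          : ∀ x → α x ≢ x

  φ : Fin #darts → Fin #darts
  φ x = σ ⟨$⟩ʳ α x

  field
    vertices : Orbits (σ ⟨$⟩ʳ_)
    edges    : Orbits α
    faces    : Orbits φ

  module V = Orbits vertices
  module E = Orbits edges
  module F = Orbits faces

  graph : Graph
  graph = record
    { order          = V.count
    ; #darts         = #darts
    ; src            = V.orbit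
    ; inv            = α
    ; inv-involutive = α-involutive
    ; inv-≢          = α-≢
    }

  -- The two darts of an edge lie on the boundaries of the two faces incident
  -- to it, so the dual edge joins the faces of x and α x.
  dual : Graph
  dual = record
    { order          = F.count
    ; #darts         = #darts
    ; src            = F.orbit
    ; inv            = α
    ; inv-involutive = α-involutive
    ; inv-≢          = α-≢
    }

-- For a connected map, Euler's formula says exactly that the surface is the
-- sphere. Connectedness is implicit in the usual definition: a disconnected plane
-- graph has a face with disconnected boundary, which is not a cycle.
record PlanarTriangulation : Set where
  field
    map : CombinatorialMap
  open CombinatorialMap map public
  field
    simple     : Graph.Simple graph
    order≥4    : 4 ≤ Graph.order graph
    connected  : Graph.Connected graph
    euler      : V.count + F.count ≡ E.count + 2
    triangular : ∀ x → iterate φ x 3 ≡ x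
                     × IsCycle graph {2} (λ i → iterate φ x (toℕ i))

data Colour : Set where
  blue red green : Colour

ProperColouring : (G : Graph) → (Graph.Vertex G → Colour) → Set
ProperColouring G colour = ∀ u v → Graph.Adjacent G u v → colour u ≢ colour v

{-# OPTIONS --safe #-}
module Submission where

-- Let S be the set of nonblue vertices; it induces a connected subgraph. While
-- S contains a cycle, one of the cycle's vertices has degree 4, and its only
-- nonblue neighbours are the two on the cycle, so removing it from S keeps the
-- induced subgraph connected and the removed nonblue vertices independent. In the end
-- S induces a tree and no face lies inside S or inside its complement, so every
-- face has exactly one dart leaving S. The contour of the tree is a single closed
-- walk that passes all these darts; in the dual they form a Hamiltonian cycle.
--
-- Acyclicity enters only through the contour: if some edge of S has different
-- contours on its two sides, then each vertex is on an even number of edges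
-- separating one of these contours from the others, which forces a cycle.

open import Defs
open import Data.Bool using (Bool; if_then_else_)
import Data.Bool.Properties as Bool
open import Data.Fin using (Fin; zero; suc; toℕ; fromℕ<)
open import Data.Fin.Permutation using (_⟨$⟩ʳ_)
open import Data.Fin.Properties
  using (_≟_; any?; pigeonhole; injective⇒≤; toℕ-fromℕ<; toℕ-injective; toℕ<n)
open import Data.Fin.Subset using (Subset; inside; outside; _∈_; _∉_; _-_; _─_; ∣_∣)
open import Data.Fin.Subset.Properties
  using (_∈?_; p─q⊆p; x∈⁅x⁆; x∈p∧x≢y⇒x∈p-y; x∈p⇒∣p-x∣<∣p∣)
open import Data.List using (List; []; _∷_; length; lookup)
open import Data.List.Membership.Propositional using () renaming (_∈_ to _∈ˡ_)
open import Data.List.Membership.Propositional.Properties using (∈-filter⁺; ∈-allFin; ∈-lookup)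
import Data.List.Membership.Setoid.Properties as Membership
open import Data.List.Relation.Unary.All as All using (All; []; _∷_)
open import Data.List.Relation.Unary.AllPairs using ([]; _∷_)
open import Data.List.Relation.Unary.Unique.Propositional using (Unique)
open import Data.Nat using (ℕ; zero; suc; _+_; _*_; _<_; _≤_; s≤s; s≤s⁻¹; _%_; _/_)
open import Data.Nat.DivMod using (_mod_; m≡m%n+[m/n]*n; m%n<n; m<n⇒m%n≡m; n%n≡0)
open import Data.Nat.GeneralisedArithmetic using (fold; iterate)
open import Data.Nat.Induction using (<-rec; <-wellFounded)
open import Data.Nat.Properties
  using (anyUpTo?; <-cmp; m≤n⇒∃[o]m+o≡n; +-suc; +-comm; +-identityʳ;
         +-monoʳ-<; +-monoˡ-<; +-monoʳ-≤; m≤n⇒m<n∨m≡n; n<1+n; suc-injective)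
open import Data.Product using (∃; ∃-syntax; _×_; _,_; proj₁; proj₂)
open import Data.Sum using (_⊎_; inj₁; inj₂)
open import Data.Vec as Vec using ([]; _∷_; here; there)
import Data.Vec.Properties as Vec
open import Function using (_∘_; case_of_)
open import Function.Bundles using (Equivalence; Injection; mk⇔)
open import Function.Definitions using (Injective)
open import Function.Properties.Inverse using (↔⇒↣)
open import Induction.WellFounded using (Acc; acc)
open import Relation.Binary.Construct.Closure.ReflexiveTransitive using (Star; ε; _◅_)
open import Relation.Binary.Definitions using (tri<; tri≈; tri>)
open import Relation.Binary.PropositionalEquality
  using (_≡_; _≢_; refl; sym; trans; cong; subst; setoid; module ≡-Reasoning)
open import Relation.Nullary using (¬_; Dec; yes; no; does; contradiction)
open import Relation.Nullary.Decidable
  using (_×-dec_; ¬?; map′; dec-true; dec-false; does-⇔; decidable-stable)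
open import Relation.Unary using (Decidable)
open Graph hiding (#darts)
open PlanarTriangulation using (graph; dual)

-- Least witnesses and iterates of a map.

Least : (ℕ → Set) → ℕ → Set
Least P n = P n × (∀ {j} → j < n → ¬ P j)

least : {P : ℕ → Set} → Decidable P → ∀ n → P n → ∃ (Least P)
least {P} P? = <-rec (λ n → P n → ∃ (Least P)) λ n rec Pn → case anyUpTo? P? n of λ where
  (yes (j , j<n , Pj)) → rec j<n Pj
  (no ∄j)              → n , Pn , λ j<n Pj → ∄j (_ , j<n , Pj)

module _ {A : Set} (f : A → A) where

  iterate-suc : ∀ x n → iterate f x (suc n) ≡ f (iterate f x n)
  iterate-suc x zero    = refl
  iterate-suc x (suc n) = iterate-suc (f x) n

  iterate-+ : ∀ x m n → iterate f x (m + n) ≡ iterate f (iterate f x m) n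
  iterate-+ x zero    n = refl
  iterate-+ x (suc m) n = iterate-+ (f x) m n

  iterate-preserves : (P : A → Set) → (∀ {x} → P x → P (f x)) →
    ∀ {x} → P x → ∀ n → P (iterate f x n)
  iterate-preserves P step Px zero    = Px
  iterate-preserves P step Px (suc n) = iterate-preserves P step (step Px) n

  iterate-% : ∀ {x} p → iterate f x (suc p) ≡ x →
    ∀ m → iterate f x (m % suc p) ≡ iterate f x m
  iterate-% {x} p period m = begin
    iterate f x (m % suc p)                         ≡⟨ cong (λ y → iterate f y (m % suc p)) (multiple q) ⟨
    iterate f (iterate f x (q * suc p)) (m % suc p) ≡⟨ iterate-+ x (q * suc p) (m % suc p) ⟨
    iterate f x (q * suc p + m % suc p)             ≡⟨ cong (iterate f x) (+-comm (q * suc p) _) ⟩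
    iterate f x (m % suc p + q * suc p)             ≡⟨ cong (iterate f x) (m≡m%n+[m/n]*n m (suc p)) ⟨
    iterate f x m                                   ∎
    where
    open ≡-Reasoning
    q = m / suc p
    multiple : ∀ q → iterate f x (q * suc p) ≡ x
    multiple zero    = refl
    multiple (suc q) = begin
      iterate f x (suc p + q * suc p)             ≡⟨ iterate-+ x (suc p) (q * suc p) ⟩
      iterate f (iterate f x (suc p)) (q * suc p) ≡⟨ cong (λ y → iterate f y (q * suc p)) period ⟩
      iterate f x (q * suc p)                     ≡⟨ multiple q ⟩
      x                                           ∎

  -- A discrete intermediate value principle. It locates where, in a full turn around a vertex, a
  -- contour-invariant value changes back.
  entry : (O : A → Bool) {b : Bool} → ∀ m {x} → O x ≢ b → O (iterate f x m) ≡ b →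
    ∃[ j ] (O (iterate f x j) ≢ b × O (f (iterate f x j)) ≡ b)
  entry O zero O≢b O≡b = contradiction O≡b O≢b
  entry O {b} (suc m) {x} O≢b O≡b with O (f x) Bool.≟ b
  ... | yes Of≡b = 0 , O≢b , Of≡b
  ... | no  Of≢b with j , p ← entry O m Of≢b O≡b = suc j , p

  Reaches : A → A → Set
  Reaches x y = ∃[ k ] iterate f x k ≡ y

  reaches-trans : ∀ {x y z} → Reaches x y → Reaches y z → Reaches x z
  reaches-trans {x} (k , refl) (l , refl) = k + l , iterate-+ x k l

-- Orbits of an injective map on a finite set.

module _ {n : ℕ} {f : Fin n → Fin n} (f-injective : Injective _≡_ _≡_ f) where

  iterate-injective : ∀ k {x y} → iterate f x k ≡ iterate f y k → x ≡ y
  iterate-injective zero    eq = eq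
  iterate-injective (suc k) eq = f-injective (iterate-injective k eq)

  -- Pigeonhole gives two equal iterates, and injectivity cancels the common initial steps, so the
  -- orbit closes up at `x` itself.
  period : ∀ x → ∃[ p ] iterate f x (suc p) ≡ x
  period x
    with i , j , i<j , eq ← pigeonhole (n<1+n n) (λ (i : Fin (suc n)) → iterate f x (toℕ i))
    with p , i+p≡j ← m≤n⇒∃[o]m+o≡n i<j
    = p , sym (iterate-injective (toℕ i) (begin
        iterate f x (toℕ i)                       ≡⟨ eq ⟩
        iterate f x (toℕ j)                       ≡⟨ cong (iterate f x) i+p≡j ⟨
        iterate f x (suc (toℕ i + p))             ≡⟨ cong (iterate f x ∘ suc) (+-comm (toℕ i) p) ⟩
        iterate f x (suc p + toℕ i)               ≡⟨ iterate-+ f x (suc p) (toℕ i) ⟩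
        iterate f (iterate f x (suc p)) (toℕ i)   ∎))
    where open ≡-Reasoning

  -- Iterates repeat modulo a period, so searching one period suffices.
  reaches? : ∀ x y → Dec (Reaches f x y)
  reaches? x y with p , period ← period x =
    map′ (λ (k , _ , eq) → k , eq)
         (λ (k , eq) → k % suc p , m%n<n k (suc p) , trans (iterate-% f p period k) eq)
         (anyUpTo? (λ k → iterate f x k ≟ y) (suc p))

  does-reaches?-step : ∀ x y → does (reaches? x (f y)) ≡ does (reaches? x y)
  does-reaches?-step x y = does-⇔ (mk⇔ back forth) (reaches? x (f y)) (reaches? x y)
    where
    back : Reaches f x (f y) → Reaches f x y
    -- `iterate f y (suc p)` unfolds to `iterate f (f y) p`, so a period of `y` leads from `f y`
    -- back to `y`.
    back r with p , eq ← period y = reaches-trans f r (p , eq)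
    forth : Reaches f x y → Reaches f x (f y)
    forth r = reaches-trans f r (1 , refl)

  does-reaches?⇒reaches : ∀ {x y} → does (reaches? x x) ≡ does (reaches? x y) → Reaches f x y
  does-reaches?⇒reaches {x} {y} eq = decidable-stable (reaches? x y) λ x↛y →
    case trans (sym (dec-true (reaches? x x) (0 , refl)))
               (trans eq (dec-false (reaches? x y) x↛y)) of λ ()

-- Cyclic successor, duplicate-free lists and subsets.

toℕ-next : ∀ {k} (i : Fin (suc k)) →
  toℕ (next i) ≡ suc (toℕ i) ⊎ (toℕ i ≡ k × toℕ (next i) ≡ 0)
toℕ-next {k} i with m≤n⇒m<n∨m≡n (toℕ<n i)
... | inj₁ i<k = inj₁ (trans (toℕ-fromℕ< _) (m<n⇒m%n≡m i<k))
... | inj₂ i≡k = inj₂ (suc-injective i≡k ,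
  trans (toℕ-fromℕ< _) (trans (cong (_% suc k) i≡k) (n%n≡0 (suc k))))

lookup-injective : {A : Set} {xs : List A} → Unique xs → Injective _≡_ _≡_ (lookup xs)
lookup-injective (x∉ ∷ u) {zero}  {zero}  eq = refl
lookup-injective (x∉ ∷ u) {zero}  {suc j} eq = contradiction eq (All.lookup x∉ (∈-lookup j))
lookup-injective (x∉ ∷ u) {suc i} {zero}  eq = contradiction (sym eq) (All.lookup x∉ (∈-lookup i))
lookup-injective (x∉ ∷ u) {suc i} {suc j} eq = cong suc (lookup-injective u eq)

-- Sending a position in `xs` to the position of the same element in `ys` is injective.
unique⇒length≤ : {A : Set} {xs ys : List A} → Unique xs → (∀ {x} → x ∈ˡ xs → x ∈ˡ ys) →
  length xs ≤ length ys
unique⇒length≤ {A} u xs⊆ys = injective⇒≤ λ {i} {j} eq → lookup-injective u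
  (Membership.index-injective (setoid A) (xs⊆ys (∈-lookup i)) (xs⊆ys (∈-lookup j)) eq)

x∈p─q⇒x∉q : ∀ {n} {x : Fin n} {p q} → x ∈ p ─ q → x ∉ q
x∈p─q⇒x∉q {p = inside  ∷ p} {outside ∷ q} here        ()
x∈p─q⇒x∉q {p = s ∷ p} {t ∷ q} (there x∈p─q) (there x∈q) = x∈p─q⇒x∉q x∈p─q x∈q

-- Connectedness of the subgraph induced by S, as the absence of a cut.
ConnectedIn : (G : Graph) → Subset (order G) → Set
ConnectedIn G S = ∀ (P : Vertex G → Bool) →
  (∀ x → src G x ∈ S → tgt G x ∈ S → P (src G x) ≡ P (tgt G x)) →
  ∀ {u v} → u ∈ S → v ∈ S → P u ≡ P v

-- Degrees, and cycles from walks.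

module _ (G : Graph) where
  open Graph G using () renaming (src to s; tgt to t)

  length≤degree : ∀ {v xs} → Unique xs → All (λ x → s x ≡ v) xs → length xs ≤ degree G v
  length≤degree {v} u at-v = unique⇒length≤ u λ {x} x∈xs →
    ∈-filter⁺ (λ x → s x ≟ v) (∈-allFin x) (All.lookup at-v x∈xs)

  -- Cut the walk at its first repeated vertex.
  walk⇒cycle : (w : ℕ → Dart G) → (∀ n → s (w (suc n)) ≡ t (w n)) →
    (∀ n → w (suc n) ≢ inv G (w n)) →
    ∃[ k ] ∃[ m ] IsCycle G {k} (λ i → w (m + toℕ i))
  walk⇒cycle w follows no-backtrack
    with i , j , i<j , eq ←
      pigeonhole (n<1+n (order G)) (λ (i : Fin (suc (order G))) → s (w (toℕ i)))
    -- `n` is the first index whose source occurred before, and `m` is the earlier index. As `n` is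
    -- `suc (m + k)`, positions `m` to `m + k` form the cycle.
    with n , (m , m<n , wm≡wn) , fresh ←
      least (λ j → anyUpTo? (λ i → s (w i) ≟ s (w j)) j) (toℕ j) (toℕ i , i<j , eq)
    with k , refl ← m≤n⇒∃[o]m+o≡n m<n
    = k , m , record
      { closed            = λ a → sym (closed a)
      ; distinct-vertices = distinct
      ; distinct-edges    = distinct-edges
      }
    where
    c : Fin (suc k) → Dart G
    c i = w (m + toℕ i)

    successor : ∀ a → c (next a) ≡ w (suc (m + toℕ a)) ⊎ (toℕ a ≡ k × toℕ (next a) ≡ 0)
    successor a with toℕ-next a
    ... | inj₁ eq = inj₁ (cong w (trans (cong (m +_) eq) (+-suc m (toℕ a))))
    ... | inj₂ eq = inj₂ eq

    closed : ∀ a → s (c (next a)) ≡ t (c a)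
    closed a with successor a
    ... | inj₁ eq = trans (cong s eq) (follows (m + toℕ a))
    ... | inj₂ (a≡k , eq) = begin
      s (w (m + toℕ (next a))) ≡⟨ cong (λ i → s (w (m + i))) eq ⟩
      s (w (m + 0))            ≡⟨ cong (λ i → s (w i)) (+-identityʳ m) ⟩
      s (w m)                  ≡⟨ wm≡wn ⟩
      s (w (suc (m + k)))      ≡⟨ cong (λ i → s (w (suc (m + i)))) a≡k ⟨
      s (w (suc (m + toℕ a)))  ≡⟨ follows (m + toℕ a) ⟩
      t (w (m + toℕ a))        ∎
      where open ≡-Reasoning

    before : ∀ (a b : Fin (suc k)) → toℕ a < toℕ b → s (c a) ≢ s (c b)
    before a b a<b eq = fresh (s≤s (+-monoʳ-≤ m (s≤s⁻¹ (toℕ<n b))))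
      (m + toℕ a , +-monoʳ-< m a<b , eq)

    distinct : Injective _≡_ _≡_ (λ i → s (c i))
    distinct {a} {b} eq with <-cmp (toℕ a) (toℕ b)
    ... | tri< a<b _ _ = contradiction eq (before a b a<b)
    ... | tri≈ _ a≡b _ = toℕ-injective a≡b
    ... | tri> _ _ b<a = contradiction (sym eq) (before b a b<a)

    distinct-edges : ∀ a b → c a ≢ inv G (c b)
    -- Mutually inverse darts start at each other's ends, so each position is the successor of the
    -- other. Either one follows the other directly and the walk backtracks, or both positions are
    -- last and a dart is its own inverse.
    distinct-edges a b eq = opposite (successor a) (successor b)
      where
      eq′ : c b ≡ inv G (c a)
      eq′ = trans (sym (inv-involutive G (c b))) (cong (inv G) (sym eq))
      a≡next-b : a ≡ next b
      a≡next-b = distinct (trans (cong s eq) (sym (closed b)))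
      b≡next-a : b ≡ next a
      b≡next-a = distinct (trans (cong s eq′) (sym (closed a)))
      opposite : c (next a) ≡ w (suc (m + toℕ a)) ⊎ (toℕ a ≡ k × toℕ (next a) ≡ 0) →
                 ¬ (c (next b) ≡ w (suc (m + toℕ b)) ⊎ (toℕ b ≡ k × toℕ (next b) ≡ 0))
      opposite (inj₁ after) _ =
        no-backtrack (m + toℕ a) (trans (sym after) (trans (cong c (sym b≡next-a)) eq′))
      opposite _ (inj₁ after) =
        no-backtrack (m + toℕ b) (trans (sym after) (trans (cong c (sym a≡next-b)) eq))
      opposite (inj₂ (a≡k , _)) (inj₂ (b≡k , _)) =
        inv-≢ G (c b) (sym (trans (cong c (toℕ-injective (trans b≡k (sym a≡k)))) eq))

-- Darts of a combinatorial map.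

module Darts (M : CombinatorialMap) where
  open CombinatorialMap M using (σ; α; φ; α-involutive; vertices; faces; #darts)
  private
    G = CombinatorialMap.graph M
    D = Fin #darts
  open Graph G using () renaming (src to s; tgt to t)

  rot : D → D
  rot = σ ⟨$⟩ʳ_

  src-rot : ∀ x → s (rot x) ≡ s x
  src-rot x = sym (Equivalence.from (Orbits.same-orbit vertices x (rot x)) (1 , refl))

  rot-injective : Injective _≡_ _≡_ rot
  rot-injective = Injection.injective (↔⇒↣ σ)

  α-injective : Injective _≡_ _≡_ α
  α-injective {x} {y} eq = trans (sym (α-involutive x)) (trans (cong α eq) (α-involutive y))

  tgt-α : ∀ x → t (α x) ≡ s x
  tgt-α x = cong s (α-involutive x)

  src-φ : ∀ x → s (φ x) ≡ t x
  src-φ x = src-rot (α x)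

  φ-α : ∀ x → φ (α x) ≡ rot x
  φ-α x = cong rot (α-involutive x)

  face-φ : ∀ x → Orbits.orbit faces (φ x) ≡ Orbits.orbit faces x
  face-φ x = sym (Equivalence.from (Orbits.same-orbit faces x (φ x)) (1 , refl))

  dart-at : Vertex G → D
  dart-at v = proj₁ (Orbits.surjective vertices v)

  src-dart-at : ∀ v → s (dart-at v) ≡ v
  src-dart-at v = proj₂ (Orbits.surjective vertices v)

  rotates-to : ∀ {x y} → s x ≡ s y → Reaches rot x y
  rotates-to {x} {y} = Equivalence.to (Orbits.same-orbit vertices x y)

-- The contour of an induced subgraph.

module Contour (M : CombinatorialMap) (S : Subset (order (CombinatorialMap.graph M))) where
  open CombinatorialMap M using (α; α-involutive; #darts)
  open Darts M
  private
    G = CombinatorialMap.graph M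
    D = Fin #darts
  open Graph G using () renaming (src to s; tgt to t)

  Inner : D → Set
  Inner x = s x ∈ S × t x ∈ S

  inner? : ∀ x → Dec (Inner x)
  inner? x = (s x ∈? S) ×-dec (t x ∈? S)

  inner-α : ∀ {x} → Inner x → Inner (α x)
  inner-α {x} (sx∈S , tx∈S) = tx∈S , subst (_∈ S) (sym (tgt-α x)) sx∈S

  -- One step of the walk around the subgraph induced by S; the darts leaving S
  -- are visited on the way.
  τ : D → D
  τ x = rot (if does (inner? x) then α x else x)

  τ-inner : ∀ {x} → Inner x → τ x ≡ rot (α x)
  τ-inner {x} p = cong (λ b → rot (if b then α x else x)) (dec-true (inner? x) p)

  τ-outer : ∀ {x} → ¬ Inner x → τ x ≡ rot x
  τ-outer {x} ¬p = cong (λ b → rot (if b then α x else x)) (dec-false (inner? x) ¬p)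

  -- `τ` is `rot` after an involution that swaps the two darts of each inner edge and fixes all
  -- other darts.
  τ-injective : Injective _≡_ _≡_ τ
  τ-injective {x} {y} eq with inner? x | inner? y
  ... | yes p | yes q = α-injective (rot-injective (trans (sym (τ-inner p)) (trans eq (τ-inner q))))
  ... | yes p | no ¬q = contradiction
    (subst Inner (rot-injective (trans (sym (τ-inner p)) (trans eq (τ-outer ¬q)))) (inner-α p)) ¬q
  ... | no ¬p | yes q = contradiction
    (subst Inner (rot-injective (trans (sym (τ-inner q)) (trans (sym eq) (τ-outer ¬p)))) (inner-α q)) ¬p
  ... | no ¬p | no ¬q = rot-injective (trans (sym (τ-outer ¬p)) (trans eq (τ-outer ¬q)))

  src-τ-inner : ∀ {x} → Inner x → s (τ x) ≡ t x
  src-τ-inner {x} p = trans (cong s (τ-inner p)) (src-rot (α x))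

  src-τ-outer : ∀ {x} → ¬ Inner x → s (τ x) ≡ s x
  src-τ-outer {x} ¬p = trans (cong s (τ-outer ¬p)) (src-rot x)

  -- The two sides of every edge of the subgraph induced by S lie on the same
  -- contour, so on the sphere this says that the subgraph is acyclic.
  Contiguous : Set
  Contiguous = ∀ x → Inner x → Reaches τ x (α x)

  module _ (O : D → Bool) (O-τ : ∀ x → O (τ x) ≡ O x) where

    -- `O` stands for a union of contours; a separating edge has exactly one of its sides in it.
    Separating : D → Set
    Separating x = Inner x × O x ≢ O (α x)

    separating-α : ∀ {x} → Separating x → Separating (α x)
    separating-α {x} (p , Ox≢) =
      inner-α p , λ eq → Ox≢ (sym (trans eq (cong O (α-involutive x))))

    -- After arriving at `s x` along `α x`, the contour turns to `rot x`.
    O-rot-inner : ∀ {x} → Inner x → O (rot x) ≡ O (α x)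
    O-rot-inner {x} p = begin
      O (rot x)         ≡⟨ cong (O ∘ rot) (α-involutive x) ⟨
      O (rot (α (α x))) ≡⟨ cong O (τ-inner (inner-α p)) ⟨
      O (τ (α x))       ≡⟨ O-τ (α x) ⟩
      O (α x)           ∎
      where open ≡-Reasoning

    -- Around a vertex, O changes exactly at the separating darts, hence never
    -- exactly once.
    another-separating : ∀ {x} → Separating x → ∃[ z ] (s z ≡ s x × z ≢ x × Separating z)
    another-separating {x} (p , Ox≢)
      with n , back ← period rot-injective x
      -- `rot x` has the value of the other side of `x`, so the value must change again before the
      -- rotation is back at `x`.
      with j , Oz≢Ox , Orz≡Ox ← entry rot O {O x} n {rot x}
             (λ eq → Ox≢ (trans (sym eq) (O-rot-inner p))) (cong O back)
      = z , at-x , (λ z≡x → Oz≢Ox (cong O z≡x)) , separating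
      where
      z = iterate rot (rot x) j
      at-x : s z ≡ s x
      at-x = iterate-preserves rot (λ z → s z ≡ s x) (trans (src-rot _)) (src-rot x) j
      separating : Separating z
      separating with inner? z
      ... | yes q = q , λ Oz≡ → Oz≢Ox (trans Oz≡ (trans (sym (O-rot-inner q)) Orz≡Ox))
      -- At a dart that is not inner the contour only rotates, so `O` cannot change there.
      ... | no ¬q = contradiction
        (trans (sym (O-τ z)) (trans (cong O (τ-outer ¬q)) Orz≡Ox)) Oz≢Ox

    turn : ((y , _) : ∃ Separating) → ∃[ z ] (s z ≡ t y × z ≢ α y × Separating z)
    turn (_ , q) = another-separating (separating-α q)

    advance : ∃ Separating → ∃ Separating
    advance e = proj₁ (turn e) , proj₂ (proj₂ (proj₂ (turn e)))

    -- At its end, every separating dart can be continued by one on a different edge, so there is an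
    -- endless walk without backtracking, and finiteness closes it up.
    separating-cycle : ∀ {x} → Separating x →
      ∃[ k ] ∃[ c ] (IsCycle G {k} c × ∀ i → Separating (c i))
    separating-cycle {x} p =
      let k , m , cycle = walk⇒cycle G (proj₁ ∘ walk)
            (λ n → proj₁ (proj₂ (turn (walk n))))
            (λ n → proj₁ (proj₂ (proj₂ (turn (walk n)))))
      in k , (λ i → proj₁ (walk (m + toℕ i))) , cycle , λ i → proj₂ (walk (m + toℕ i))
      where
      walk : ℕ → ∃ Separating
      walk = fold (x , p) advance

    -- If x is separating, the contour walk starting with x returns to its
    -- source through y and not through x.
    connected-remove : (∀ x → s x ≢ t x) → ConnectedIn G S →
      ∀ {x y} → Separating x →
      (∀ z → Inner z → s z ≡ s x → z ≡ x ⊎ z ≡ y) →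
      ConnectedIn G (S - s x)
    connected-remove loopless connected {x} {y} (p , Ox≢) only P P-const u∈ v∈ =
      -- `P` is extended to the removed vertex by its value at the neighbour `t x`, so that
      -- connectedness of `S` applies.
      trans (sym (extend-≢ u∈))
        (trans (connected P′ P′-const (p─q⊆p _ _ u∈) (p─q⊆p _ _ v∈)) (extend-≢ v∈))
      where
      P-inner : ∀ {z} → Inner z → s z ≢ s x → t z ≢ s x → P (s z) ≡ P (t z)
      P-inner (sz∈ , tz∈) sz≢ tz≢ = P-const _ (x∈p∧x≢y⇒x∈p-y sz∈ sz≢) (x∈p∧x≢y⇒x∈p-y tz∈ tz≢)

      only-in : ∀ {z} → Inner z → t z ≡ s x → z ≡ α x ⊎ z ≡ α y
      only-in {z} r tz≡ with only (α z) (inner-α r) tz≡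
      ... | inj₁ eq = inj₁ (trans (sym (α-involutive z)) (cong α eq))
      ... | inj₂ eq = inj₂ (trans (sym (α-involutive z)) (cong α eq))

      -- `P` keeps the value `P (t x)` along the contour until the contour comes back to `s x`.
      follow : ∀ m z → O z ≡ O x → s z ≢ s x → P (s z) ≡ P (t x) →
        s (iterate τ z m) ≡ s x → P (t x) ≡ P (t y)
      follow zero z Oz sz≢ Pz back = contradiction back sz≢
      follow (suc m) z Oz sz≢ Pz back with inner? z
      ... | no ¬r = follow m (τ z) (trans (O-τ z) Oz)
        (λ eq → sz≢ (trans (sym (src-τ-outer ¬r)) eq))
        (trans (cong P (src-τ-outer ¬r)) Pz)
        back
      ... | yes r with t z ≟ s x
      ...   | no tz≢ = follow m (τ z) (trans (O-τ z) Oz)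
        (λ eq → tz≢ (trans (sym (src-τ-inner r)) eq))
        (trans (cong P (src-τ-inner r)) (trans (sym (P-inner r sz≢ tz≢)) Pz))
        back
      ...   | yes tz≡ with only-in r tz≡
      -- `α x` has the other value of `O`, so the return is along `α y`, which starts at `t y`.
      ...     | inj₁ refl = contradiction (sym Oz) Ox≢
      ...     | inj₂ refl = sym Pz

      same-side : P (t x) ≡ P (t y)
      same-side with n , back ← period τ-injective x = follow n (τ x) (O-τ x)
        (λ eq → loopless x (sym (trans (sym (src-τ-inner p)) eq)))
        (cong P (src-τ-inner p)) (cong s back)

      P′ : Vertex G → Bool
      P′ v = if does (v ≟ s x) then P (t x) else P v

      P′-≢ : ∀ {v} → v ≢ s x → P′ v ≡ P v
      P′-≢ {v} eq = cong (λ b → if b then P (t x) else P v) (dec-false (v ≟ s x) eq)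

      extend-≢ : ∀ {v} → v ∈ S - s x → P′ v ≡ P v
      extend-≢ v∈ = P′-≢ λ { refl → x∈p─q⇒x∉q v∈ (x∈⁅x⁆ _) }

      P-neighbour : ∀ {z} → Inner z → s z ≡ s x → P (t z) ≡ P (t x)
      P-neighbour r sz≡ with only _ r sz≡
      ... | inj₁ refl = refl
      ... | inj₂ refl = sym same-side

      P′-const : ∀ z → s z ∈ S → t z ∈ S → P′ (s z) ≡ P′ (t z)
      P′-const z sz∈ tz∈ with s z ≟ s x | t z ≟ s x
      ... | yes sz≡ | yes tz≡ = contradiction (trans sz≡ (sym tz≡)) (loopless z)
      ... | yes sz≡ | no  tz≢ = sym (P-neighbour (sz∈ , tz∈) sz≡)
      ... | no  sz≢ | yes tz≡ =
        trans (cong P (sym (tgt-α z))) (P-neighbour (inner-α (sz∈ , tz∈)) tz≡)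
      ... | no  sz≢ | no  tz≢ = P-inner (sz∈ , tz∈) sz≢ tz≢

  -- The orbit of `x` contains both or neither of the darts of an inner edge, hence all or none of
  -- the darts at a vertex of `S`. It thus descends to a predicate on `S`, which connectedness makes
  -- constant.
  contiguous⇒transitive : Contiguous → ConnectedIn G S →
    ∀ {x y} → s x ∈ S → s y ∈ S → Reaches τ x y
  contiguous⇒transitive contiguous connected {x} {y} sx∈ sy∈ =
    does-reaches?⇒reaches τ-injective O-const
    where
    open ≡-Reasoning
    O : D → Bool
    O z = does (reaches? τ-injective x z)

    O-τ : ∀ z → O (τ z) ≡ O z
    O-τ = does-reaches?-step τ-injective x

    O-α : ∀ {z} → Inner z → O z ≡ O (α z)
    O-α {z} p with n , eq ← contiguous z p = sym (trans (cong O (sym eq))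
      (iterate-preserves τ (λ y → O y ≡ O z) (trans (O-τ _)) refl n))

    O-rot : ∀ {z} → s z ∈ S → O (rot z) ≡ O z
    O-rot {z} sz∈ with inner? z
    ... | yes p = trans (O-rot-inner O O-τ p) (sym (O-α p))
    ... | no ¬p = trans (cong O (sym (τ-outer ¬p))) (O-τ z)

    P : Vertex G → Bool
    P v = O (dart-at v)

    O≡P : ∀ {z} → s z ∈ S → O z ≡ P (s z)
    O≡P {z} sz∈
      with n , eq ← rotates-to {z} (sym (src-dart-at (s z)))
      = sym (trans (cong O (sym eq)) (proj₂ (iterate-preserves rot (λ y → s y ∈ S × O y ≡ O z)
          (λ {y} (sy∈ , eq) → subst (_∈ S) (sym (src-rot y)) sy∈ , trans (O-rot sy∈) eq)
          (sz∈ , refl) n)))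

    O-const : O x ≡ O y
    O-const = begin
      O x     ≡⟨ O≡P sx∈ ⟩
      P (s x) ≡⟨ connected P (λ z sz∈ tz∈ →
                   trans (sym (O≡P sz∈)) (trans (O-α (sz∈ , tz∈)) (O≡P tz∈))) sx∈ sy∈ ⟩
      P (s y) ≡⟨ O≡P sy∈ ⟨
      O y     ∎

-- The three colours.

blue? : ∀ c → Dec (c ≡ blue)
blue? blue  = yes refl
blue? red   = no λ ()
blue? green = no λ ()

red⊎green : ∀ {c} → c ≢ blue → c ≡ red ⊎ c ≡ green
red⊎green {blue}  c≢ = contradiction refl c≢
red⊎green {red}   _  = inj₁ refl
red⊎green {green} _  = inj₂ refl

some-blue : ∀ {a b c} → a ≢ b → b ≢ c → c ≢ a → a ≡ blue ⊎ b ≡ blue ⊎ c ≡ blue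
some-blue {blue}                    _   _   _   = inj₁ refl
some-blue {_}     {blue}            _   _   _   = inj₂ (inj₁ refl)
some-blue {_}     {_}     {blue}    _   _   _   = inj₂ (inj₂ refl)
some-blue {red}   {red}             a≢b _   _   = contradiction refl a≢b
some-blue {red}   {green} {red}     _   _   c≢a = contradiction refl c≢a
some-blue {red}   {green} {green}   _   b≢c _   = contradiction refl b≢c
some-blue {green} {green}           a≢b _   _   = contradiction refl a≢b
some-blue {green} {red}   {green}   _   _   c≢a = contradiction refl c≢a
some-blue {green} {red}   {red}     _   b≢c _   = contradiction refl b≢c

-- Faces, links and vertices of degree 4 in a coloured triangulation.

module Coloured (T : PlanarTriangulation)
  (colour : Vertex (graph T) → Colour) (proper : ProperColouring (graph T) colour) where
  open PlanarTriangulation T 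
    using (map; α; φ; faces; simple; triangular; connected; order≥4; #darts)
  open Darts map
  private
    G = graph T
    D = Fin #darts
    face = Orbits.orbit faces
  open Graph G using () renaming (src to s; tgt to t)

  Nonblue : Vertex G → Set
  Nonblue v = colour v ≢ blue

  proper-dart : ∀ x → colour (s x) ≢ colour (t x)
  proper-dart x = proper (s x) (t x) (x , refl , refl)

  φ³ : ∀ x → φ (φ (φ x)) ≡ x
  φ³ x = proj₁ (triangular x)

  tgt-φ² : ∀ x → t (φ (φ x)) ≡ s x
  tgt-φ² x = trans (sym (src-φ (φ (φ x)))) (cong s (φ³ x))

  same-face : ∀ {x y} → face x ≡ face y → y ≡ x ⊎ y ≡ φ x ⊎ y ≡ φ (φ x)
  same-face {x} {y} eq with n , refl ← Equivalence.to (Orbits.same-orbit faces x y) eq =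
    iterate-preserves φ (λ y → y ≡ x ⊎ y ≡ φ x ⊎ y ≡ φ (φ x)) (λ where
      (inj₁ refl)        → inj₂ (inj₁ refl)
      (inj₂ (inj₁ refl)) → inj₂ (inj₂ refl)
      (inj₂ (inj₂ refl)) → inj₁ (φ³ x)) (inj₁ refl) n

  proper-φ : ∀ x → colour (s x) ≢ colour (s (φ x))
  proper-φ x eq = proper-dart x (trans eq (cong colour (src-φ x)))

  face-blue : ∀ x → colour (s x) ≡ blue ⊎ colour (s (φ x)) ≡ blue ⊎ colour (s (φ (φ x))) ≡ blue
  face-blue x = some-blue (proper-φ x) (proper-φ (φ x))
    (λ eq → proper-φ (φ (φ x)) (trans eq (cong (colour ∘ s) (sym (φ³ x)))))

  -- The edge of the link of s x that joins two consecutive neighbours.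
  link : D → D
  link x = φ (rot x)

  src-link : ∀ x → s (link x) ≡ t (rot x)
  src-link x = src-φ (rot x)

  tgt-link : ∀ x → t (link x) ≡ t x
  tgt-link x = trans (cong (λ y → t (φ y)) (sym (φ-α x))) (tgt-φ² (α x))

  proper-link : ∀ x → colour (t (rot x)) ≢ colour (t x)
  proper-link x eq = proper-dart (link x)
    (trans (cong colour (src-link x)) (trans eq (cong colour (sym (tgt-link x)))))

  -- `x`, `rot x` and the link edge between their ends bound a face, whose three vertices have three
  -- different colours.
  rot-blue : ∀ x → Nonblue (s x) → Nonblue (t x) → colour (t (rot x)) ≡ blue
  rot-blue x sx tx with some-blue (proper-dart x) (proper-link x ∘ sym)
      (λ eq → proper-dart (rot x) (trans (cong colour (src-rot x)) (sym eq)))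
  ... | inj₁ eq        = contradiction eq sx
  ... | inj₂ (inj₁ eq) = contradiction eq tx
  ... | inj₂ (inj₂ eq) = eq

  -- Of the four darts at such a vertex, rot x and rot y lead to blue vertices.
  degree-4 : ∀ {x y z} → degree G (s x) ≡ 4 → Nonblue (s x) → s y ≡ s x → s z ≡ s x →
    y ≢ x → Nonblue (t x) → Nonblue (t y) → Nonblue (t z) → z ≡ x ⊎ z ≡ y
  degree-4 {x} {y} {z} deg sx sy≡ sz≡ y≢x tx ty tz with z ≟ x | z ≟ y
  ... | yes z≡x | _       = inj₁ z≡x
  ... | no  _   | yes z≡y = inj₂ z≡y
  -- Otherwise `x`, `y`, `z`, `rot x` and `rot y` would be five distinct darts at a vertex of degree
  -- 4.
  ... | no  z≢x | no  z≢y = contradiction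
    (subst (5 ≤_) deg (length≤degree G
      ( ((y≢x ∘ sym) ∷ (z≢x ∘ sym) ∷ apart tx rx ∷ apart tx ry ∷ [])
      ∷ ((z≢y ∘ sym) ∷ apart ty rx ∷ apart ty ry ∷ [])
      ∷ (apart tz rx ∷ apart tz ry ∷ [])
      ∷ ((y≢x ∘ sym ∘ rot-injective) ∷ [])
      ∷ [] ∷ [])
      (refl ∷ sy≡ ∷ sz≡ ∷ src-rot x ∷ trans (src-rot y) sy≡ ∷ [])))
    (λ { (s≤s (s≤s (s≤s (s≤s ())))) })
    where
    rx : colour (t (rot x)) ≡ blue
    rx = rot-blue x sx tx
    ry : colour (t (rot y)) ≡ blue
    ry = rot-blue y (λ eq → sx (trans (cong colour (sym sy≡)) eq)) ty
    apart : ∀ {u v} → Nonblue (t u) → colour (t v) ≡ blue → u ≢ v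
    apart tu tv refl = tu tv

  -- The nonblue vertices as the starting set.

  nonblue : Subset (order G)
  nonblue = Vec.tabulate λ v → does (¬? (blue? (colour v)))

  nonblue⁺ : ∀ {v} → Nonblue v → v ∈ nonblue
  nonblue⁺ {v} v≢ = Vec.lookup⇒[]= v _
    (trans (Vec.lookup∘tabulate _ v) (dec-true (¬? (blue? (colour v))) v≢))

  nonblue⁻ : ∀ {v} → v ∈ nonblue → Nonblue v
  nonblue⁻ {v} v∈ eq = case trans (sym (Vec.[]=⇒lookup v∈)) (trans (Vec.lookup∘tabulate _ v)
    (dec-false (¬? (blue? (colour v))) (λ v≢ → v≢ eq))) of λ ()

  -- A path through a blue vertex can be rerouted along its link.
  nonblue-connected : ConnectedIn G nonblue
  nonblue-connected P P-const {u} {v} u∈ v∈ =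
    trans (sym (P′-nonblue (nonblue⁻ u∈))) (trans (along (connected u v)) (P′-nonblue (nonblue⁻ v∈)))
    where
    P-nonblue : ∀ x → Nonblue (s x) → Nonblue (t x) → P (s x) ≡ P (t x)
    P-nonblue x sx tx = P-const x (nonblue⁺ sx) (nonblue⁺ tx)

    -- A blue vertex gets the value of an arbitrary neighbour. All its neighbours agree, since
    -- consecutive ones are joined by a link edge with nonblue ends.
    P′ : Vertex G → Bool
    P′ v = if does (blue? (colour v)) then P (t (dart-at v)) else P v

    P′-blue : ∀ {v} → colour v ≡ blue → P′ v ≡ P (t (dart-at v))
    P′-blue {v} eq = cong (λ b → if b then P (t (dart-at v)) else P v) (dec-true (blue? (colour v)) eq)

    P′-nonblue : ∀ {v} → Nonblue v → P′ v ≡ P v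
    P′-nonblue {v} eq =
      cong (λ b → if b then P (t (dart-at v)) else P v) (dec-false (blue? (colour v)) eq)

    around : ∀ {x y} → colour (s x) ≡ blue → s x ≡ s y → P (t y) ≡ P (t x)
    around {x} {y} sx eq with n , refl ← rotates-to eq =
      proj₂ (iterate-preserves rot (λ y → colour (s y) ≡ blue × P (t y) ≡ P (t x))
        (λ {y} (sy , eq) → trans (cong colour (src-rot y)) sy , trans (step y sy) eq) (sx , refl) n)
      where
      step : ∀ y → colour (s y) ≡ blue → P (t (rot y)) ≡ P (t y)
      step y sy = begin
        P (t (rot y))  ≡⟨ cong P (src-link y) ⟨
        P (s (link y)) ≡⟨ P-nonblue (link y)
          (λ eq → proper-dart (rot y) (trans (cong colour (src-rot y))
            (trans sy (trans (sym eq) (cong colour (src-link y))))))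
          (λ eq → proper-dart y (trans sy (trans (sym eq) (cong colour (tgt-link y))))) ⟩
        P (t (link y)) ≡⟨ cong P (tgt-link y) ⟩
        P (t y)        ∎
        where open ≡-Reasoning

    from-blue : ∀ x → colour (s x) ≡ blue → P′ (s x) ≡ P′ (t x)
    from-blue x sx = trans (P′-blue sx) (trans (around sx (sym (src-dart-at (s x))))
      (sym (P′-nonblue λ tx → proper-dart x (trans sx (sym tx)))))

    P′-const : ∀ x → P′ (s x) ≡ P′ (t x)
    P′-const x = by-colour (blue? _) (blue? _)
      where
      by-colour : Dec (colour (s x) ≡ blue) → Dec (colour (t x) ≡ blue) → P′ (s x) ≡ P′ (t x)
      by-colour (yes sx) _        = from-blue x sx
      by-colour (no sx)  (yes tx) = sym (trans (from-blue (α x) tx) (cong P′ (tgt-α x)))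
      by-colour (no sx)  (no tx)  =
        trans (P′-nonblue sx) (trans (P-nonblue x sx tx) (sym (P′-nonblue tx)))

    along : ∀ {u v} → Star (Adjacent G) u v → P′ u ≡ P′ v
    along ε = refl
    along ((x , refl , refl) ◅ walk) = trans (P′-const x) (along walk)

  -- Admissible sets and their shrinking.

  record Admissible (S : Subset (order G)) : Set where
    field
      avoids-blue : ∀ {v} → v ∈ S → Nonblue v
      -- Independence of the nonblue vertices outside `S`; it keeps a face from lying wholly outside
      -- `S`.
      covers      : ∀ x → Nonblue (s x) → Nonblue (t x) → s x ∈ S ⊎ t x ∈ S
      connectedIn : ConnectedIn G S

  nonblue-admissible : Admissible nonblue
  nonblue-admissible = record
    { avoids-blue = nonblue⁻
    ; covers      = λ x sx tx → inj₁ (nonblue⁺ sx)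
    ; connectedIn = nonblue-connected
    }

  CyclesMeetDegree4 : Set
  CyclesMeetDegree4 = ∀ {k : ℕ} (c : Fin (suc k) → D) → IsCycle G c →
    (∀ i → colour (s (c i)) ≡ red ⊎ colour (s (c i)) ≡ green) →
    ∃[ i ] degree G (s (c i)) ≡ 4

  module _ {S : Subset (order G)} (admissible : Admissible S) where
    open Contour map S
    open Admissible admissible

    -- By `degree-4`, the ends of `x` and `y` are the only nonblue neighbours of the removed vertex.
    -- Both stay in the set, which preserves independence, and the contour through `x` joins them,
    -- which preserves connectedness.
    remove-admissible : (O : D → Bool) (O-τ : ∀ x → O (τ x) ≡ O x) →
      ∀ {x y} → degree G (s x) ≡ 4 → Separating O O-τ x → t y ∈ S → s y ≡ s x → y ≢ x →
      Admissible (S - s x)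
    remove-admissible O O-τ {x} {y} deg x-separating@((sx∈ , tx∈) , _) ty∈ sy≡ y≢ = record
      { avoids-blue = avoids-blue ∘ p─q⊆p _ _
      ; covers      = covers′
      ; connectedIn = connected-remove O O-τ loopless connectedIn x-separating
          (λ z (_ , tz∈) sz≡ → only sz≡ (avoids-blue tz∈))
      }
      where
      loopless : ∀ z → s z ≢ t z
      loopless = proj₁ simple

      only : ∀ {z} → s z ≡ s x → Nonblue (t z) → z ≡ x ⊎ z ≡ y
      only sz≡ = degree-4 deg (avoids-blue sx∈) sy≡ sz≡ y≢ (avoids-blue tx∈) (avoids-blue ty∈)

      remains : ∀ {z} → s z ≡ s x → Nonblue (t z) → t z ∈ S - s x
      remains {z} sz≡ tz with only sz≡ tz
      ... | inj₁ refl = x∈p∧x≢y⇒x∈p-y tx∈ (loopless x ∘ sym)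
      ... | inj₂ refl = x∈p∧x≢y⇒x∈p-y ty∈ (λ eq → loopless y (trans sy≡ (sym eq)))

      covers′ : ∀ z → Nonblue (s z) → Nonblue (t z) → s z ∈ S - s x ⊎ t z ∈ S - s x
      covers′ z sz tz with s z ≟ s x | t z ≟ s x
      ... | yes sz≡ | _       = inj₂ (remains sz≡ tz)
      ... | no  _   | yes tz≡ = inj₁ (subst (_∈ S - s x) (tgt-α z)
        (remains tz≡ (λ eq → sz (trans (cong colour (sym (tgt-α z))) eq))))
      ... | no sz≢  | no tz≢ with covers z sz tz
      ...   | inj₁ sz∈ = inj₁ (x∈p∧x≢y⇒x∈p-y sz∈ sz≢)
      ...   | inj₂ tz∈ = inj₂ (x∈p∧x≢y⇒x∈p-y tz∈ tz≢)

    contiguous? : Contiguous ⊎ ∃[ x ] (Inner x × ¬ Reaches τ x (α x))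
    contiguous? = decide (any? λ x → inner? x ×-dec ¬? (reaches? τ-injective x (α x)))
      where
      decide : Dec (∃[ x ] (Inner x × ¬ Reaches τ x (α x))) →
        Contiguous ⊎ ∃[ x ] (Inner x × ¬ Reaches τ x (α x))
      decide (yes ∃x) = inj₂ ∃x
      decide (no ∄x)  = inj₁ λ x p →
        decidable-stable (reaches? τ-injective x (α x)) λ ¬r → ∄x (x , p , ¬r)

    -- With `O` the contour of `e`, the edge of `e` is separating and yields a cycle of separating
    -- darts in `S`. At its vertex of degree 4, a second separating dart serves as the `y` of
    -- `remove-admissible`.
    shrink : CyclesMeetDegree4 → ∀ {e} → Inner e → ¬ Reaches τ e (α e) →
      ∃[ v ] (v ∈ S × Admissible (S - v))
    shrink meets {e} e-inner e↛αe = along (separating-cycle O O-τ (e-inner , differ))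
      where
      O : D → Bool
      O y = does (reaches? τ-injective e y)

      O-τ : ∀ x → O (τ x) ≡ O x
      O-τ = does-reaches?-step τ-injective e

      differ : O e ≢ O (α e)
      differ eq = e↛αe (does-reaches?⇒reaches τ-injective eq)

      at : ∀ {x} → degree G (s x) ≡ 4 → Separating O O-τ x →
        ∃[ z ] (s z ≡ s x × z ≢ x × Separating O O-τ z) → ∃[ v ] (v ∈ S × Admissible (S - v))
      at {x} deg x-separating (_ , sz≡ , z≢ , (_ , tz∈) , _) =
        s x , proj₁ (proj₁ x-separating) , remove-admissible O O-τ deg x-separating tz∈ sz≡ z≢

      along : ∃[ k ] ∃[ c ] (IsCycle G {k} c × (∀ i → Separating O O-τ (c i))) →
        ∃[ v ] (v ∈ S × Admissible (S - v))
      along (_ , c , cycle , separating)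
        with i , deg ← meets c cycle (λ i → red⊎green (avoids-blue (proj₁ (proj₁ (separating i)))))
        = at deg (separating i) (another-separating O O-τ (separating i))

  -- Every removal lowers the size of `S`, so shrinking ends, and it can only end at a contiguous
  -- set.
  contiguous-subset : CyclesMeetDegree4 → ∀ S → Acc _<_ ∣ S ∣ → Admissible S →
    ∃[ S′ ] (Admissible S′ × Contour.Contiguous map S′)
  contiguous-subset meets S (acc rec) admissible = decide (contiguous? admissible)
    where
    continue : ∃[ v ] (v ∈ S × Admissible (S - v)) →
      ∃[ S′ ] (Admissible S′ × Contour.Contiguous map S′)
    continue (v , v∈S , admissible′) =
      contiguous-subset meets (S - v) (rec (x∈p⇒∣p-x∣<∣p∣ v∈S)) admissible′

    decide : Contour.Contiguous map S ⊎
      (∃[ x ] (Contour.Inner map S x × ¬ Reaches (Contour.τ map S) x (α x))) →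
      ∃[ S′ ] (Admissible S′ × Contour.Contiguous map S′)
    decide (inj₁ contiguous) = S , admissible , contiguous
    decide (inj₂ (_ , p , ¬r)) = continue (shrink admissible meets p ¬r)

  -- The Hamiltonian cycle of the dual.

  module DualCycle (S : Subset (order G)) (admissible : Admissible S)
    (contiguous : Contour.Contiguous map S) where
    open Contour map S
    open Admissible admissible

    Crossing : D → Set
    Crossing x = s x ∈ S × t x ∉ S

    -- Every face has a blue vertex, and `S` avoids blue.
    not-all-in : ∀ d → s d ∈ S → s (φ d) ∈ S → s (φ (φ d)) ∉ S
    not-all-in d 0∈ 1∈ 2∈ with face-blue d
    ... | inj₁ 0-blue        = avoids-blue 0∈ 0-blue
    ... | inj₂ (inj₁ 1-blue) = avoids-blue 1∈ 1-blue
    ... | inj₂ (inj₂ 2-blue) = avoids-blue 2∈ 2-blue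

    one-in : ∀ x → Nonblue (s x) → Nonblue (s (φ x)) → ¬ (s x ∉ S × s (φ x) ∉ S)
    one-in x sx sφx (sx∉ , sφx∉) with covers x sx (subst Nonblue (src-φ x) sφx)
    ... | inj₁ sx∈ = sx∉ sx∈
    ... | inj₂ tx∈ = sφx∉ (subst (_∈ S) (sym (src-φ x)) tx∈)

    -- Besides its blue vertex a face has two adjacent nonblue ones, and `covers` puts one of them
    -- in `S`.
    not-all-out : ∀ d → s d ∉ S → s (φ d) ∉ S → ¬ (s (φ (φ d)) ∉ S)
    not-all-out d 0∉ 1∉ 2∉ with face-blue d
    ... | inj₁ 0-blue = one-in (φ d)
      (λ 1-blue → proper-φ d (trans 0-blue (sym 1-blue)))
      (λ 2-blue → proper-φ (φ (φ d)) (trans 2-blue (trans (sym 0-blue) (cong (colour ∘ s) (sym (φ³ d))))))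
      (1∉ , 2∉)
    ... | inj₂ (inj₁ 1-blue) = one-in (φ (φ d))
      (λ 2-blue → proper-φ (φ d) (trans 1-blue (sym 2-blue)))
      (λ 0-blue → proper-φ d (trans (cong (colour ∘ s) (sym (φ³ d))) (trans 0-blue (sym 1-blue))))
      (2∉ , subst (λ x → s x ∉ S) (sym (φ³ d)) 0∉)
    ... | inj₂ (inj₂ 2-blue) = one-in d
      (λ 0-blue → proper-φ (φ (φ d)) (trans 2-blue (trans (sym 0-blue) (cong (colour ∘ s) (sym (φ³ d))))))
      (λ 1-blue → proper-φ (φ d) (trans 1-blue (sym 2-blue)))
      (0∉ , 1∉)

    -- Going round a triangle with vertices both in and outside `S`, some dart leads out of `S`.
    crossing-in-face : ∀ d → ∃[ x ] (face x ≡ face d × Crossing x)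
    crossing-in-face d with s d ∈? S | s (φ d) ∈? S | s (φ (φ d)) ∈? S
    ... | yes 0∈ | no  1∉ | _      = d , refl , 0∈ , subst (_∉ S) (src-φ d) 1∉
    ... | _      | yes 1∈ | no  2∉ = φ d , face-φ d , 1∈ , subst (_∉ S) (src-φ (φ d)) 2∉
    ... | no  0∉ | _      | yes 2∈ =
      φ (φ d) , trans (face-φ (φ d)) (face-φ d) , 2∈ , subst (_∉ S) (sym (tgt-φ² d)) 0∉
    ... | yes 0∈ | yes 1∈ | yes 2∈ = contradiction 2∈ (not-all-in d 0∈ 1∈)
    ... | no  0∉ | no  1∉ | no  2∉ = contradiction 2∉ (not-all-out d 0∉ 1∉)

    -- In a triangle, the dart after a crossing one starts outside `S` and the dart before it ends
    -- inside, so neither is crossing.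
    crossing-unique : ∀ {x y} → Crossing x → Crossing y → face x ≡ face y → x ≡ y
    crossing-unique {x} (sx∈ , tx∉) (sy∈ , ty∉) eq with same-face eq
    ... | inj₁ refl        = refl
    ... | inj₂ (inj₁ refl) = contradiction (subst (_∈ S) (src-φ x) sy∈) tx∉
    ... | inj₂ (inj₂ refl) = contradiction (subst (_∈ S) (sym (tgt-φ² x)) sx∈) ty∉

    -- The first crossing dart after x on the contour of S.
    ψ : D → D
    ψ x = if does (t (rot x) ∈? S) then φ (rot x) else rot x

    ψ-in : ∀ {x} → t (rot x) ∈ S → ψ x ≡ φ (rot x)
    ψ-in {x} p = cong (λ b → if b then φ (rot x) else rot x) (dec-true (t (rot x) ∈? S) p)

    ψ-out : ∀ {x} → t (rot x) ∉ S → ψ x ≡ rot x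
    ψ-out {x} ¬p = cong (λ b → if b then φ (rot x) else rot x) (dec-false (t (rot x) ∈? S) ¬p)

    src-rot∈ : ∀ {x} → s x ∈ S → s (rot x) ∈ S
    src-rot∈ {x} = subst (_∈ S) (sym (src-rot x))

    -- If `rot x` is inner, the contour runs along it and turns to `φ (rot x)`, the link edge back
    -- to `t x`, which is outside `S`. So at most one inner dart separates two crossing darts.
    ψ-crossing : ∀ {x} → Crossing x → Crossing (ψ x)
    ψ-crossing {x} (sx∈ , tx∉) = by-target (t (rot x) ∈? S)
      where
      by-target : Dec (t (rot x) ∈ S) → Crossing (ψ x)
      by-target (yes p) = subst Crossing (sym (ψ-in p))
        (subst (_∈ S) (sym (src-link x)) p , subst (_∉ S) (sym (tgt-link x)) tx∉)
      by-target (no ¬p) = subst Crossing (sym (ψ-out ¬p)) (src-rot∈ sx∈ , ¬p)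

    -- `rot x` is `φ (α x)`, and `φ` stays in its face. This makes successive crossing darts
    -- consecutive edges of a walk in the dual.
    face-ψ : ∀ x → face (ψ x) ≡ face (α x)
    face-ψ x = by-target (t (rot x) ∈? S)
      where
      face-rot : face (rot x) ≡ face (α x)
      face-rot = trans (cong face (sym (φ-α x))) (face-φ (α x))
      by-target : Dec (t (rot x) ∈ S) → face (ψ x) ≡ face (α x)
      by-target (yes p) = trans (cong face (ψ-in p)) (trans (face-φ (rot x)) face-rot)
      by-target (no ¬p) = trans (cong face (ψ-out ¬p)) face-rot

    ψ-transitive : ∀ {x y} → Crossing x → Crossing y → Reaches ψ x y
    ψ-transitive {x} {y} x-crossing (sy∈ , ty∉)
      with n , τⁿx≡y ← contiguous⇒transitive contiguous connectedIn (proj₁ x-crossing) sy∈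
      = case subst Visited τⁿx≡y (iterate-preserves τ Visited visit (inj₁ (0 , refl)) n) of λ where
          (inj₁ r)        → r
          (inj₂ (_ , ty∈)) → contradiction ty∈ ty∉
      where
      -- Invariant that lets `ψ` simulate `τ`: the contour is at a crossing dart reached by `ψ`, or
      -- on the inner dart right after one.
      Visited : D → Set
      Visited z = Reaches ψ x z ⊎ ((∃[ w ] (Reaches ψ x w × rot w ≡ z)) × t z ∈ S)

      crossing : ∀ {z} → Reaches ψ x z → Crossing z
      crossing (j , refl) = iterate-preserves ψ Crossing ψ-crossing x-crossing j

      visit : ∀ {z} → Visited z → Visited (τ z)
      visit {z} (inj₁ r) = subst Visited (sym (τ-outer (proj₂ (crossing r) ∘ proj₂)))
        (by-target (t (rot z) ∈? S))
        where
        by-target : Dec (t (rot z) ∈ S) → Visited (rot z)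
        by-target (yes p) = inj₂ ((z , r , refl) , p)
        by-target (no ¬p) = inj₁ (reaches-trans ψ r (1 , ψ-out ¬p))
      visit (inj₂ ((w , r , refl) , p)) = inj₁ (reaches-trans ψ r
        (1 , trans (ψ-in p) (sym (τ-inner (src-rot∈ (proj₁ (crossing r)) , p)))))

    some-crossing : ∃ Crossing
    -- `order≥4` unfolds to `3 < order` and so provides a vertex, whose dart selects a face.
    some-crossing with x , _ , p ← crossing-in-face (dart-at (fromℕ< order≥4)) = x , p

    module _ {x : D} {k : ℕ} (x-crossing : Crossing x)
      (least-period : Least (λ k → iterate ψ x (suc k) ≡ x) k) where

      period-ψ : iterate ψ x (suc k) ≡ x
      period-ψ = proj₁ least-period

      c : Fin (suc k) → D
      c i = iterate ψ x (toℕ i)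

      c-crossing : ∀ i → Crossing (c i)
      c-crossing i = iterate-preserves ψ Crossing ψ-crossing x-crossing (toℕ i)

      c-next : ∀ i → c (next i) ≡ ψ (c i)
      c-next i with toℕ-next i
      ... | inj₁ eq = trans (cong (iterate ψ x) eq) (iterate-suc ψ x (toℕ i))
      ... | inj₂ (i≡k , eq) = begin
        iterate ψ x (toℕ (next i)) ≡⟨ cong (iterate ψ x) eq ⟩
        x                          ≡⟨ period-ψ ⟨
        iterate ψ x (suc k)        ≡⟨ iterate-suc ψ x k ⟩
        ψ (iterate ψ x k)          ≡⟨ cong (ψ ∘ iterate ψ x) i≡k ⟨
        ψ (c i)                    ∎
        where open ≡-Reasoning

      distinct : ∀ (i j : Fin (suc k)) → toℕ i < toℕ j → c i ≢ c j
      -- With `j + r` equal to `k`, the remaining `suc r` steps lead from `c j` to `x`. Taken from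
      -- the equal dart `c i`, they return to `x` sooner than the least period allows.
      distinct i j i<j eq with r , j+r≡k ← m≤n⇒∃[o]m+o≡n (s≤s⁻¹ (toℕ<n j)) =
        proj₂ least-period (subst (toℕ i + r <_) j+r≡k (+-monoˡ-< r i<j)) (begin
          iterate ψ x (suc (toℕ i + r))         ≡⟨ cong (iterate ψ x) (+-suc (toℕ i) r) ⟨
          iterate ψ x (toℕ i + suc r)           ≡⟨ iterate-+ ψ x (toℕ i) (suc r) ⟩
          iterate ψ (c i) (suc r)               ≡⟨ cong (λ y → iterate ψ y (suc r)) eq ⟩
          iterate ψ (c j) (suc r)               ≡⟨ iterate-+ ψ x (toℕ j) (suc r) ⟨
          iterate ψ x (toℕ j + suc r)           ≡⟨ cong (iterate ψ x) (+-suc (toℕ j) r) ⟩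
          iterate ψ x (suc (toℕ j + r))         ≡⟨ cong (iterate ψ x ∘ suc) j+r≡k ⟩
          iterate ψ x (suc k)                   ≡⟨ period-ψ ⟩
          x                                     ∎)
        where open ≡-Reasoning

      c-injective : Injective _≡_ _≡_ c
      c-injective {i} {j} eq with <-cmp (toℕ i) (toℕ j)
      ... | tri< i<j _ _ = contradiction eq (distinct i j i<j)
      ... | tri≈ _ i≡j _ = toℕ-injective i≡j
      ... | tri> _ _ j<i = contradiction (sym eq) (distinct j i j<i)

      c-mod : ∀ m → c (m mod suc k) ≡ iterate ψ x m
      c-mod m = trans (cong (iterate ψ x) (toℕ-fromℕ< (m%n<n m (suc k)))) (iterate-% ψ k period-ψ m)

      visits : ∀ v → ∃[ i ] face (c i) ≡ v
      visits v =
        let d , face-d≡v               = Orbits.surjective faces v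
            z , same-face , z-crossing = crossing-in-face d
            m , eq                     = ψ-transitive x-crossing z-crossing
        in m mod suc k , trans (cong face (trans (c-mod m) eq)) (trans same-face face-d≡v)

      orbit-hamiltonian : Hamiltonian (dual T)
      orbit-hamiltonian = k , c , record
        { closed            = λ i → sym (trans (cong face (c-next i)) (face-ψ (c i)))
        ; distinct-vertices = λ {i} {j} eq →
            c-injective (crossing-unique (c-crossing i) (c-crossing j) eq)
        -- The reverse of a crossing dart starts outside `S`, so it is not itself crossing.
        ; distinct-edges    = λ i j eq →
            proj₂ (c-crossing j) (subst (λ y → s y ∈ S) eq (proj₁ (c-crossing i)))
        } , visits

    hamiltonian : Hamiltonian (dual T)
    hamiltonian =
      let x , x-crossing = some-crossing
          -- Starting from `ψ x` rather than `x` makes the total number of steps back to `x`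
          -- positive.
          n , return     = ψ-transitive (ψ-crossing x-crossing) x-crossing
          _ , is-least   = least (λ k → iterate ψ x (suc k) ≟ x) n return
      in orbit-hamiltonian x-crossing is-least

corollary2 : (T : PlanarTriangulation) →
    let G = graph T in
    Eulerian G →
    (colour : Vertex G → Colour) →
    ProperColouring G colour →
    (∀ {k : ℕ} (c : Fin (suc k) → Dart G) → IsCycle G c →
    (∀ i → colour (src G (c i)) ≡ red ⊎ colour (src G (c i)) ≡ green) →
    ∃[ i ] degree G (src G (c i)) ≡ 4) →
    Hamiltonian (dual T)
corollary2 T _ colour proper meets =
  let S , admissible , contiguous = contiguous-subset meets nonblue (<-wellFounded _) nonblue-admissible
  in DualCycle.hamiltonian S admissible contiguous
  where open Coloured T colour proper
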